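{- Let $\mathcal B$ be a blockchain, let $\mathit{Txs}$ be a finite sequence of transactions, and let $tx$ be a transaction. Suppose $\mathrm{valid}(\mathcal B;\mathit{Txs};tx)$ and $\mathrm{valid}(\mathcal B;tx)$. Then: (1) $\mathrm{valid}(\mathcal B;tx;\mathit{Txs})$, and (2) $\mathcal B;tx;\mathit{Txs}\cong\mathcal B;\mathit{Txs};tx$.
   Context: Idealised EUTxO. Fix a solution of the following type equations (the choice of the subset $\mathsf{Validator}$ is left unspecified): $\mathsf{Redeemer}=\mathsf{CurrencySymbol}=\mathsf{TokenName}=\mathsf{Position}=\mathbb N$; $\mathsf{Chip}=\mathsf{CurrencySymbol}\times\mathsf{TokenName}$; $\mathsf{Datum}=\mathbb N$; $\mathsf{Value}$ is the set of finite partial functions from $\mathsf{Chip}$ to $\mathbb N_{>0}$; $\mathsf{Validator}\subseteq \mathcal P(\mathsf{Redeemer}\times\mathsf{Datum}\times\mathsf{Value}\times\mathsf{Context})$, where $\mathcal P$ is powerset; $\mathsf{Input}=\mathsf{Position}\times\mathsf{Redeemer}$; $\mathsf{Output}=\mathsf{Position}\times\mathsf{Validator}\times\mathsf{Datum}\times\mathsf{Value}$; $\mathsf{Transaction}$ is the set of pairs $(I,O)$ with $I$ a finite subset of $\mathsf{Input}$ and $O$ a finite subset of $\mathsf{Output}$ (either may be empty); $\mathsf{Context}$ is the set of $((I,i),O)$ with $(I,O)\in\mathsf{Transaction}$ and $i\in I$. If $tx=(I,O)$ is a transaction and $i\in I$, write $tx@i$ for the context $((I,i),O)$. An input $i$ points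 to an output $o$ when $i$ and $o$ have the same position (first component). $\mathit{Txs}$ ranges over finite sequences of transactions; inputs and outputs appearing in $\mathit{Txs}$ are understood as occurrences (in a given transaction of the sequence), and "earlier"/"later" refer to strictly earlier/later transactions in the sequence. A (valid) blockchain is a finite sequence of transactions $\mathit{Txs}$ such that: (i) distinct outputs appearing in $\mathit{Txs}$ have distinct positions; (ii) every input $i$ in some $tx$ in $\mathit{Txs}$ points to a unique output, denoted $\mathit{Txs}(i)$, in some earlier transaction, and distinct inputs appearing in $\mathit{Txs}$ have distinct positions; (iii) if an input $i=(p,k)$ appears in $tx$ in $\mathit{Txs}$ and points to the earlier output $\mathit{Txs}(i)=(p,V,s,v)$, then $(k,s,v,tx@i)\in V$. Write $\mathrm{valid}(\mathit{Txs})$ for "$\mathit{Txs}$ is a blockchain". The symbol $;$ denotes concatenation of sequences of transactions (a single transaction being treated as a one-element sequence). For any finite sequence of transactions $\mathit{Txs}$, an output appearing in $\mathit{Txs}$ is spent (in $\mathit{Txs}$) when a later input points to it, and otherwise unspent. $\mathrm{UTxO}(\mathit{Txs})$ is the set of unspent outputs in $\mathit{Txs}$. Write $\mathit{Txs}\cong\mathit{Txs}'$ (observational equivalence) when $\mathrm{UTxO}(\mathit{Txs})=\mathrm{UTxO}(\mathit{Txs}')$. -}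

module Defs where

open import Level using (Level; _⊔_; 0ℓ) renaming (suc to lsuc)
open import Data.Nat.Base using (ℕ; NonZero)
open import Data.Fin.Base using (Fin; _<_)
open import Data.List.Base using (List; length; lookup)
open import Data.Maybe using (Maybe; Is-just)
open import Data.Product using (Σ-syntax; ∃-syntax; ∃!; _×_; _,_; proj₁; proj₂)
open import Data.Product.Relation.Binary.Pointwise.NonDependent using (_×ₛ_)
open import Data.Refinement.Base using (Refinement-syntax)
import Data.List.Membership.Propositional as List
import Data.List.Membership.Setoid as Membership
import Data.List.Relation.Binary.Subset.Setoid as Subset
open import Relation.Binary.Bundles using (Setoid)
open import Relation.Binary.Core using (Rel)
open import Relation.Binary.Definitions using (_Respects_)
import Relation.Binary.Construct.On as On
open import Relation.Binary.PropositionalEquality using (_≡_; _≢_; setoid; _→-setoid_)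
open import Relation.Nullary.Negation using (¬_)
open import Relation.Unary using (Pred; _≐_)
open import Relation.Unary.Relation.Binary.Equality using (≐-setoid)

Redeemer CurrencySymbol TokenName Position Datum Chip Input : Set
Redeemer       = ℕ
CurrencySymbol = ℕ
TokenName      = ℕ
Position       = ℕ
Datum          = ℕ
Chip           = CurrencySymbol × TokenName
Input          = Position × Redeemer

-- The positivity proof is irrelevant, so equality is equality in ℕ.
ℕ⁺ : Set
ℕ⁺ = [ n ∈ ℕ ∣ NonZero n ]

record Value : Set where
  field
    amount  : Chip → Maybe ℕ⁺
    -- Any list covering the domain will do; equality of values ignores it.
    support : List Chip
    finite  : ∀ c → Is-just (amount c) → c List.∈ support

valueSetoid : Setoid 0ℓ 0ℓ
valueSetoid = On.setoid (Chip →-setoid Maybe ℕ⁺) Value.amount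

-- A finite subset is represented by a list of its elements; order and
-- multiplicity carry no information, and two lists denote the same subset
-- when they have the same elements.
SameSubset : ∀ {c ℓ} (S : Setoid c ℓ) → Rel (List (Setoid.Carrier S)) (c ⊔ ℓ)
SameSubset S xs ys = xs ⊆ ys × ys ⊆ xs
  where open Subset S

module Carriers {a : Level} (Validator : Set a) where

  Output : Set a
  Output = Position × Validator × Datum × Value

  Transaction : Set a
  Transaction = List Input × List Output

  inputs : Transaction → List Input
  inputs = proj₁

  outputs : Transaction → List Output
  outputs = proj₂

  record Context : Set a where
    constructor context
    field
      transaction : Transaction
      focus       : Input
      focus∈      : focus List.∈ inputs transaction

  _at_ : (tx : Transaction) {i : Input} → i List.∈ inputs tx → Context
  tx at i∈ = context tx _ i∈

-- A solution of the type equations. The subset Validator of the powerset of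
-- Redeemer × Datum × Value × Context is given as a family of predicates ⟦_⟧
-- whose indices are identified when their predicates are extensionally equal.
record Solution (a ℓ : Level) : Set (lsuc (a ⊔ ℓ)) where
  field
    Validator : Set a

  open Carriers Validator public

  field
    ⟦_⟧ : Validator → Pred (Redeemer × Datum × Value × Context) ℓ

  validatorSetoid : Setoid a (a ⊔ ℓ)
  validatorSetoid = On.setoid (≐-setoid (Redeemer × Datum × Value × Context) ℓ) ⟦_⟧

  outputSetoid : Setoid a (a ⊔ ℓ)
  outputSetoid = setoid Position ×ₛ (validatorSetoid ×ₛ (setoid Datum ×ₛ valueSetoid))

  open Setoid outputSetoid public using () renaming (_≈_ to _≈ᴼ_)
  open Setoid valueSetoid public using () renaming (_≈_ to _≈ⱽ_)

  _≈ᵀ_ : Rel Transaction (a ⊔ ℓ)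
  (I , O) ≈ᵀ (I′ , O′) = SameSubset (setoid Input) I I′ × SameSubset outputSetoid O O′

  _≈ᶜ_ : Rel Context (a ⊔ ℓ)
  context tx i _ ≈ᶜ context tx′ i′ _ = tx ≈ᵀ tx′ × i ≡ i′

  _≈ᴬ_ : Rel (Redeemer × Datum × Value × Context) (a ⊔ ℓ)
  (k , s , v , c) ≈ᴬ (k′ , s′ , v′ , c′) = k ≡ k′ × s ≡ s′ × v ≈ⱽ v′ × c ≈ᶜ c′

  field
    -- Validators see values and contexts only as finite partial functions and
    -- finite sets, not their representations.
    ⟦⟧-resp : ∀ V → ⟦ V ⟧ Respects _≈ᴬ_

module EUTxO {a ℓ : Level} (S : Solution a ℓ) where
  open Solution S public
  open Membership outputSetoid using () renaming (_∈_ to _∈ᴼ_)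

  -- Occurrences of inputs and outputs. Equality ignores the membership proofs,
  -- so a repeated list entry within one transaction is a single occurrence.
  record InputIn (Txs : List Transaction) : Set a where
    constructor inputIn
    field
      index   : Fin (length Txs)
      input   : Input
      appears : input List.∈ inputs (lookup Txs index)

  record OutputIn (Txs : List Transaction) : Set (a ⊔ ℓ) where
    constructor outputIn
    field
      index   : Fin (length Txs)
      output  : Output
      appears : output ∈ᴼ outputs (lookup Txs index)

  module _ {Txs : List Transaction} where

    inputPosition : InputIn Txs → Position
    inputPosition i = proj₁ (InputIn.input i)

    outputPosition : OutputIn Txs → Position
    outputPosition o = proj₁ (OutputIn.output o)

    _≈ᵢ_ : Rel (InputIn Txs) 0ℓ
    i ≈ᵢ i′ = InputIn.index i ≡ InputIn.index i′ × InputIn.input i ≡ InputIn.input i′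

    _≈ₒ_ : Rel (OutputIn Txs) (a ⊔ ℓ)
    o ≈ₒ o′ = OutputIn.index o ≡ OutputIn.index o′ × OutputIn.output o ≈ᴼ OutputIn.output o′

    _PointsTo_ : InputIn Txs → OutputIn Txs → Set
    i PointsTo o = inputPosition i ≡ outputPosition o

    _EarlierThan_ : OutputIn Txs → InputIn Txs → Set
    o EarlierThan i = OutputIn.index o < InputIn.index i

    Spent : Pred (OutputIn Txs) a
    Spent o = ∃[ i ] (o EarlierThan i × i PointsTo o)

    Unspent : Pred (OutputIn Txs) a
    Unspent o = ¬ Spent o

    Accepts : OutputIn Txs → InputIn Txs → Set ℓ
    Accepts (outputIn _ (_ , V , s , v) _) (inputIn n (_ , k) i∈) =
      ⟦ V ⟧ (k , s , v , lookup Txs n at i∈)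

  record Valid (Txs : List Transaction) : Set (a ⊔ ℓ) where
    field
      distinctOutputs : (o o′ : OutputIn Txs) → ¬ (o ≈ₒ o′) → outputPosition o ≢ outputPosition o′
      uniqueSource    : (i : InputIn Txs) → ∃! _≈ₒ_ (λ o → i PointsTo o × o EarlierThan i)
      distinctInputs  : (i i′ : InputIn Txs) → ¬ (i ≈ᵢ i′) → inputPosition i ≢ inputPosition i′
      -- By uniqueSource, o can only be the source of i.
      accepted        : (i : InputIn Txs) (o : OutputIn Txs) →
                        i PointsTo o → o EarlierThan i → Accepts o i

  UTxO : List Transaction → Pred Output (a ⊔ ℓ)
  UTxO Txs o = Σ[ n ∈ Fin (length Txs) ] Σ[ o∈ ∈ o ∈ᴼ outputs (lookup Txs n) ]
                 Unspent {Txs} (outputIn n o o∈)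

  infix 4 _≅_

  _≅_ : Rel (List Transaction) (a ⊔ ℓ)
  Txs ≅ Txs′ = UTxO Txs ≐ UTxO Txs′

{-# OPTIONS --safe #-}
-- Reading B;tx;Txs as a rearrangement of B;Txs;tx, everything in validity and
-- in the UTxO set is invariant under permuting occurrences, except "earlier".
-- But for an input pointing to an output, "earlier" agrees in the two orders:
-- * if the output precedes the input only in B;tx;Txs, then the source of the
--   input in B;Txs;tx is another output with the same position;
-- * if it does so only in B;Txs;tx, then the input belongs to tx, and its
--   source in B;tx is another output with the same position.
module Submission where

open import Defs
open import Level using (Level)
open import Data.Empty using (⊥; ⊥-elim)
open import Data.Fin.Base using (Fin; zero; suc; _<_; punchIn)
open import Data.Fin.Patterns using (1F)
open import Data.Fin.Permutation
  using (Permutation; permutation; lift₀; _⟨$⟩ʳ_; _⟨$⟩ˡ_; inverseˡ; inverseʳ)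
open import Data.Fin.Properties using (<-cmp; <-trans; <-asym; <-irrefl)
open import Data.List.Base using (List; []; _∷_; _++_; [_]; length; lookup)
import Data.List.Membership.Propositional as List
import Data.List.Membership.Setoid as Membership
open import Data.Nat.Base using (z<s; s<s; s<s⁻¹)
open import Data.Product.Base using (∃-syntax; _×_; _,_; proj₁; proj₂)
open import Function.Bundles using (module Injection)
open import Function.Properties.Inverse using (↔⇒↣)
open import Relation.Binary.Definitions using (tri<; tri≈; tri>)
open import Relation.Binary.PropositionalEquality
  using (_≡_; _≢_; refl; sym; trans; cong; subst)

private variable
  ℓ′ : Level
  A : Set ℓ′

module _ {x : A} where

  -- The head `x` travels to the end by adjacent swaps: each step exchanges it with the next entry
  -- `y` and recurses on the tail.
  toLast : ∀ xs → Fin (length (x ∷ xs)) → Fin (length (xs ++ [ x ]))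
  toLast []       i             = i
  toLast (y ∷ xs) zero          = suc (toLast xs zero)
  toLast (y ∷ xs) (suc zero)    = zero
  toLast (y ∷ xs) (suc (suc i)) = suc (toLast xs (suc i))

  fromLast : ∀ xs → Fin (length (xs ++ [ x ])) → Fin (length (x ∷ xs))
  fromLast []       i       = i
  fromLast (y ∷ xs) zero    = 1F
  -- Undoing the swap puts `y` right behind `x`, so index 1 has to be left free for it.
  fromLast (y ∷ xs) (suc i) = punchIn 1F (fromLast xs i)

  toLast-punchIn : ∀ y xs i → toLast (y ∷ xs) (punchIn 1F i) ≡ suc (toLast xs i)
  toLast-punchIn y xs zero    = refl
  toLast-punchIn y xs (suc i) = refl

  toLast-fromLast : ∀ xs i → toLast xs (fromLast xs i) ≡ i
  toLast-fromLast []       i       = refl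
  toLast-fromLast (y ∷ xs) zero    = refl
  toLast-fromLast (y ∷ xs) (suc i) =
    trans (toLast-punchIn y xs (fromLast xs i)) (cong suc (toLast-fromLast xs i))

  fromLast-toLast : ∀ xs i → fromLast xs (toLast xs i) ≡ i
  fromLast-toLast []       i             = refl
  fromLast-toLast (y ∷ xs) zero          = cong (punchIn 1F) (fromLast-toLast xs zero)
  fromLast-toLast (y ∷ xs) (suc zero)    = refl
  fromLast-toLast (y ∷ xs) (suc (suc i)) = cong (punchIn 1F) (fromLast-toLast xs (suc i))

  lookup-toLast : ∀ xs i → lookup (x ∷ xs) i ≡ lookup (xs ++ [ x ]) (toLast xs i)
  lookup-toLast []       zero          = refl
  lookup-toLast (y ∷ xs) zero          = lookup-toLast xs zero
  lookup-toLast (y ∷ xs) (suc zero)    = refl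
  lookup-toLast (y ∷ xs) (suc (suc i)) = lookup-toLast xs (suc i)

  -- Only `x`, at index 0, jumps over anything; all other indices drop by one.
  toLast-suc-mono-< : ∀ xs {i j : Fin (length xs)} → i < j →
                      toLast xs (suc i) < toLast xs (suc j)
  toLast-suc-mono-< (y ∷ xs) {zero}  {suc j} i<j = z<s
  toLast-suc-mono-< (y ∷ xs) {suc i} {suc j} i<j = s<s (toLast-suc-mono-< xs (s<s⁻¹ i<j))

  delay : ∀ bs xs → Permutation (length (bs ++ x ∷ xs)) (length (bs ++ xs ++ [ x ]))
  delay []       xs = permutation (toLast xs) (fromLast xs) (toLast-fromLast xs) (fromLast-toLast xs)
  delay (b ∷ bs) xs = lift₀ (delay bs xs)

  lookup-delay : ∀ bs xs i →
                 lookup (bs ++ x ∷ xs) i ≡ lookup (bs ++ xs ++ [ x ]) (delay bs xs ⟨$⟩ʳ i)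
  lookup-delay []       xs i       = lookup-toLast xs i
  lookup-delay (b ∷ bs) xs zero    = refl
  lookup-delay (b ∷ bs) xs (suc i) = lookup-delay bs xs i

  injectPrefix : ∀ bs xs → Fin (length (bs ++ [ x ])) → Fin (length (bs ++ x ∷ xs))
  injectPrefix []       xs zero    = zero
  injectPrefix (b ∷ bs) xs zero    = zero
  injectPrefix (b ∷ bs) xs (suc i) = suc (injectPrefix bs xs i)

  lookup-injectPrefix : ∀ bs xs i →
                        lookup (bs ++ x ∷ xs) (injectPrefix bs xs i) ≡ lookup (bs ++ [ x ]) i
  lookup-injectPrefix []       xs zero    = refl
  lookup-injectPrefix (b ∷ bs) xs zero    = refl
  lookup-injectPrefix (b ∷ bs) xs (suc i) = lookup-injectPrefix bs xs i

  injectPrefix-mono-< : ∀ bs xs {i j} → i < j → injectPrefix bs xs i < injectPrefix bs xs j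
  injectPrefix-mono-< []       xs {zero}  {zero}  ()
  injectPrefix-mono-< (b ∷ bs) xs {zero}  {suc j} i<j = z<s
  injectPrefix-mono-< (b ∷ bs) xs {suc i} {suc j} i<j = s<s (injectPrefix-mono-< bs xs (s<s⁻¹ i<j))

  -- Entries of `bs` stay put and among the rest only `x` is overtaken, so the smaller index of an
  -- inverted pair is that of `x`. It is presented as an index of `bs ++ [ x ]` so that validity of
  -- the shorter chain can be applied there.
  delay-inversion : ∀ bs xs {i j} → i < j → (delay bs xs ⟨$⟩ʳ j) < (delay bs xs ⟨$⟩ʳ i) →
                    ∃[ k ] i ≡ injectPrefix bs xs k
  delay-inversion []       xs {zero}  {j}     i<j πj<πi = zero , refl
  delay-inversion []       xs {suc i} {suc j} i<j πj<πi =
    ⊥-elim (<-asym πj<πi (toLast-suc-mono-< xs (s<s⁻¹ i<j)))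
  delay-inversion (b ∷ bs) xs {suc i} {suc j} i<j πj<πi
    with k , refl ← delay-inversion bs xs (s<s⁻¹ i<j) (s<s⁻¹ πj<πi) = suc k , refl

module _ {a ℓ : Level} (S : Solution a ℓ) where
  open EUTxO S
  open Valid
  open Membership outputSetoid using () renaming (_∈_ to _∈ᴼ_)

  private variable
    T T′ : List Transaction

  -- Only the index and the membership proof change. The input itself is kept definitionally, so one
  -- proof of `PointsTo` serves before and after a move.
  moveInput : (i : InputIn T) (n : Fin (length T′)) →
              lookup T (InputIn.index i) ≡ lookup T′ n → InputIn T′
  moveInput (inputIn _ x x∈) n eq = inputIn n x (subst (λ t → x List.∈ inputs t) eq x∈)

  moveOutput : (o : OutputIn T) (n : Fin (length T′)) →
               lookup T (OutputIn.index o) ≡ lookup T′ n → OutputIn T′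
  moveOutput (outputIn _ x x∈) n eq = outputIn n x (subst (λ t → x ∈ᴼ outputs t) eq x∈)

  distinctPositions : Valid T → (o o′ : OutputIn T) → OutputIn.index o ≢ OutputIn.index o′ →
                      outputPosition o ≢ outputPosition o′
  distinctPositions valid o o′ n≢n′ =
    distinctOutputs valid o o′ (λ o≈o′ → n≢n′ (proj₁ o≈o′))

  -- The source of `i` comes before `i`, hence before `o`, and would be a second output at the
  -- position of `o`.
  notBeforeTarget : Valid T → (i : InputIn T) (o : OutputIn T) → i PointsTo o →
                    InputIn.index i < OutputIn.index o → ⊥
  notBeforeTarget valid i o i↦o i<o with uniqueSource valid i
  ... | o′ , (i↦o′ , o′<i) , _ =
    distinctPositions valid o′ o
      (λ n≡n′ → <-irrefl n≡n′ (<-trans o′<i i<o)) (trans (sym i↦o′) i↦o)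

  module Reindexing (T T′ : List Transaction) (π : Permutation (length T) (length T′))
    (lookup-π : ∀ n → lookup T n ≡ lookup T′ (π ⟨$⟩ʳ n)) where

    π-injective : ∀ {m n} → π ⟨$⟩ʳ m ≡ π ⟨$⟩ʳ n → m ≡ n
    π-injective = Injection.injective (↔⇒↣ π)

    imageᵢ : InputIn T → InputIn T′
    imageᵢ i = moveInput i (π ⟨$⟩ʳ InputIn.index i) (lookup-π _)

    imageₒ : OutputIn T → OutputIn T′
    imageₒ o = moveOutput o (π ⟨$⟩ʳ OutputIn.index o) (lookup-π _)

    lookup-π⁻¹ : ∀ n → lookup T′ n ≡ lookup T (π ⟨$⟩ˡ n)
    lookup-π⁻¹ n = sym (trans (lookup-π (π ⟨$⟩ˡ n)) (cong (lookup T′) (inverseʳ π)))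

    preimageᵢ : InputIn T′ → InputIn T
    preimageᵢ i = moveInput i (π ⟨$⟩ˡ InputIn.index i) (lookup-π⁻¹ _)

    preimageₒ : OutputIn T′ → OutputIn T
    preimageₒ o = moveOutput o (π ⟨$⟩ˡ OutputIn.index o) (lookup-π⁻¹ _)

    Accepts-image⁻ : ∀ o i → Accepts (imageₒ o) (imageᵢ i) → Accepts o i
    Accepts-image⁻ (outputIn _ (_ , V , s , v) _) (inputIn n (p , k) i∈) =
      transport (lookup-π n) i∈
      where
      -- The transaction occurs both in the context and in the type of the membership proof, so the
      -- two lookups are generalised to variables before matching on `refl`.
      transport : ∀ {t t′} (eq : t ≡ t′) (i∈ : (p , k) List.∈ inputs t) →
                  ⟦ V ⟧ (k , s , v , t′ at subst (λ t → (p , k) List.∈ inputs t) eq i∈) →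
                  ⟦ V ⟧ (k , s , v , t at i∈)
      transport refl _ acc = acc

    module OrderAgrees
      (preserves : ∀ i o → i PointsTo o → o EarlierThan i → imageₒ o EarlierThan imageᵢ i)
      (reflects  : ∀ i o → i PointsTo o → imageₒ o EarlierThan imageᵢ i → o EarlierThan i)
      where

      -- Each condition is checked on images in `T′`. Sources found there are brought back by
      -- `reflects`; sources given in `T` are sent over by `preserves`.
      valid-preimage : Valid T′ → Valid T
      valid-preimage valid .distinctOutputs o o′ o≉o′ =
        distinctOutputs valid (imageₒ o) (imageₒ o′)
          (λ (πm≡πn , x≈x′) → o≉o′ (π-injective πm≡πn , x≈x′))
      valid-preimage valid .distinctInputs i i′ i≉i′ =
        distinctInputs valid (imageᵢ i) (imageᵢ i′)
          (λ (πm≡πn , x≡x′) → i≉i′ (π-injective πm≡πn , x≡x′))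
      valid-preimage valid .accepted i o i↦o o<i =
        Accepts-image⁻ o i
          (accepted valid (imageᵢ i) (imageₒ o) i↦o (preserves i o i↦o o<i))
      valid-preimage valid .uniqueSource i with uniqueSource valid (imageᵢ i)
      ... | o , (i↦o , o<i) , unique =
        preimageₒ o
        , (i↦o , reflects i (preimageₒ o) i↦o (subst (_< _) (sym (inverseʳ π)) o<i))
        , λ {o′} (i↦o′ , o′<i) →
            -- A rival source `o′` is compared with `o` in `T′`, and the equality of indices is then
            -- pulled back along the inverse of `π`.
            let n≡πn′ , x≈x′ = unique {imageₒ o′} (i↦o′ , preserves i o′ i↦o′ o′<i)
            in trans (cong (π ⟨$⟩ˡ_) n≡πn′) (inverseˡ π) , x≈x′

      -- Being unspent is a negation, so spenders travel against outputs: `to` pulls them back with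
      -- `reflects`, `from` pushes them forward with `preserves`.
      UTxO-≅ : T ≅ T′
      UTxO-≅ = (λ {x} → to {x}) , (λ {x} → from {x})
        where
        to : ∀ {x} → UTxO T x → UTxO T′ x
        to {x} (n , x∈ , unspent) =
          OutputIn.index (imageₒ o) , OutputIn.appears (imageₒ o) , λ (i , o<i , i↦o) →
            unspent (preimageᵢ i
                    , reflects (preimageᵢ i) o i↦o (subst (_ <_) (sym (inverseʳ π)) o<i)
                    , i↦o)
          where
          o : OutputIn T
          o = outputIn n x x∈

        from : ∀ {x} → UTxO T′ x → UTxO T x
        from {x} (n , x∈ , unspent) =
          OutputIn.index (preimageₒ o) , OutputIn.appears (preimageₒ o) , λ (i , o<i , i↦o) →
            unspent (imageᵢ i
                    , subst (_< _) (inverseʳ π) (preserves i (preimageₒ o) i↦o o<i)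
                    , i↦o)
          where
          o : OutputIn T′
          o = outputIn n x x∈

  module Delay (B Txs : List Transaction) (tx : Transaction)
    (valid-late : Valid (B ++ Txs ++ [ tx ])) (valid-early : Valid (B ++ [ tx ])) where

    π = delay {x = tx} B Txs

    -- The sequence known to be valid is taken as the target of `π`, because validity is pulled
    -- back.
    open Reindexing (B ++ [ tx ] ++ Txs) (B ++ Txs ++ [ tx ]) π (lookup-delay {x = tx} B Txs)

    ι = injectPrefix {x = tx} B Txs

    -- How `π` moves indices is irrelevant beyond injectivity: validity of the late order excludes
    -- the inverted case.
    preserves : ∀ i o → i PointsTo o → o EarlierThan i → imageₒ o EarlierThan imageᵢ i
    preserves i o i↦o o<i
      with <-cmp (OutputIn.index (imageₒ o)) (InputIn.index (imageᵢ i))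
    ... | tri< πo<πi _ _ = πo<πi
    ... | tri≈ _ πo≡πi _ = ⊥-elim (<-irrefl (π-injective πo≡πi) o<i)
    ... | tri> _ _ πi<πo = ⊥-elim (notBeforeTarget valid-late (imageᵢ i) (imageₒ o) i↦o πi<πo)

    noInversion : ∀ i o → i PointsTo o → InputIn.index i < OutputIn.index o →
                  imageₒ o EarlierThan imageᵢ i → ⊥
    noInversion i o i↦o i<o πo<πi
      with k , i≡ιk ← delay-inversion B Txs i<o πo<πi
      -- The input is viewed inside `B ++ [ tx ]`, whose validity gives it a source `s` before index
      -- `k`.
      with s , (i↦s , s<k) , _ ← uniqueSource valid-early
             (moveInput i k (trans (cong (lookup (B ++ tx ∷ Txs)) i≡ιk) (lookup-injectPrefix B Txs k))) =
      -- Distinctness of positions is available in the late order, so `s′` and `o` are compared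
      -- through their images. Their own indices differ because `s′` precedes `i` and `i` precedes
      -- `o`.
      distinctPositions valid-late (imageₒ s′) (imageₒ o)
        (λ πs≡πo → <-irrefl (π-injective πs≡πo) (<-trans s<i i<o)) (trans (sym i↦s) i↦o)
      where
      s′ = moveOutput s (ι (OutputIn.index s)) (sym (lookup-injectPrefix B Txs _))
      s<i : s′ EarlierThan i
      s<i = subst (_ <_) (sym i≡ιk) (injectPrefix-mono-< B Txs s<k)

    reflects : ∀ i o → i PointsTo o → imageₒ o EarlierThan imageᵢ i → o EarlierThan i
    reflects i o i↦o πo<πi with <-cmp (OutputIn.index o) (InputIn.index i)
    ... | tri< o<i _ _ = o<i
    ... | tri≈ _ o≡i _ = ⊥-elim (<-irrefl (cong (π ⟨$⟩ʳ_) o≡i) πo<πi)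
    ... | tri> _ _ i<o = ⊥-elim (noInversion i o i↦o i<o πo<πi)

    open OrderAgrees preserves reflects public

theorem2p17 : ∀ {a ℓ} (S : Solution a ℓ) → let open EUTxO S in
    (B Txs : List Transaction) (tx : Transaction) →
    Valid B →
    Valid (B ++ Txs ++ [ tx ]) →
    Valid (B ++ [ tx ]) →
    Valid (B ++ [ tx ] ++ Txs) × (B ++ [ tx ] ++ Txs ≅ B ++ Txs ++ [ tx ])
theorem2p17 S B Txs tx _ valid-late valid-early = valid-preimage valid-late , UTxO-≅
  where open Delay S B Txs tx valid-late valid-early
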